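{- Let $\mathcal A=(A,\le,\mathrm{app},\to,\mathsf k,\mathsf s,\Phi)$ be a full adjunction implicative ordered combinatory algebra, and let $\mathcal K=\mathcal K_{\mathcal A\bullet}$ be the abstract Krivine structure with $\Lambda=\Pi=A$, $s\perp\pi\iff s\le\pi$, $\mathrm{app}(s,t)=st$, $\mathrm{push}(s,\pi)=s\to\pi$, $\mathsf K=\mathsf k$, $\mathsf S=\mathsf s$, $\mathrm{QP}=\Phi$. Consider the preorder $(A,\sqsubseteq)$, where $a\sqsubseteq a'$ iff there is $r\in\Phi$ with $ra\le a'$, and the preorder $(\mathcal P_\bullet(A),\sqsubseteq_\bullet)$ computed in $\mathcal K$, where $C\sqsubseteq_\bullet C'$ iff there is $t\in\Phi$ with $t\le x$ for every $x\in C\to_\bullet C'$. Then these preorders are equivalent; more precisely, $\rho:\mathcal P_\bullet(A)\to A$, $\rho(C)=\inf C$, is an equivalence of preorders. Consequently the Heyting preorder $\mathcal H_{\mathcal A}$ associated to $\mathcal A$ is equivalent to the Heyting preorder $\mathcal H_{\mathcal A_{\mathcal K\bullet}}$ associated to the full adjunction implicative ordered combinatory algebra $\mathcal A_{\mathcal K\bullet}$ built from $\mathcal K$.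
   Context: A full adjunction implicative ordered combinatory algebra is an inf-complete poset $(A,\le)$ with application $ab$ monotone in both arguments, implication $a\to b$ antimonotone in the first and monotone in the second argument, elements $\mathsf k,\mathsf s$ with $\mathsf k ab\le a$, $\mathsf s abc\le ac(bc)$, such that $a\le b\to c\iff ab\le c$, and a subset $\Phi\subseteq A$ closed under application containing $\mathsf s,\mathsf k$. Its Heyting preorder $\mathcal H_{\mathcal A}$ has underlying preorder $(A,\sqsubseteq)$ as in the claim. In $\mathcal K$: polars ${}^\perp P=\{t:\forall\pi\in P,\ t\le\pi\}$, $L^\perp=\{\pi:\forall t\in L,\ t\le\pi\}$; $\overline P=({}^\perp P)^\perp$; $\widehat P=\bigcup_{\pi\in P}\overline{\{\pi\}}$; $\mathcal P_\bullet(A)=\{P\subseteq A:\widehat P=P\}$; $C\to_\bullet C'=\widehat{\{s\to\pi:s\in{}^\perp C,\pi\in C'\}}$. $\mathcal A_{\mathcal K\bullet}$ has carrier $\mathcal P_\bullet(A)$ ordered by $\supseteq$, application $P\circ_\bullet Q=\{\pi:s\to\pi'\in P\ \forall s\in{}^\perp Q,\ \pi'\in\overline{\{\pi\}}\}$, implication $\to_\bullet$, and filter $\{P\in\mathcal P_\bullet(A):\exists t\in\Phi,\ t\le P\}$; its Heyting preorder has order $Q\sqsubseteq R$ iff some $F$ in this filter has $F\circ_\bullet Q\supseteq R$, and this order coincides with $\sqsubseteq_\bullet$. A monotone map of preorders is an equivalence if it has a monotone weak inverse (compositions pointwise isomorphic to identities). -}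

module Defs where

open import Data.Product.Base using (Σ; Σ-syntax; ∃; ∃-syntax; _×_; _,_; proj₁; proj₂)
open import Function.Bundles using (_⇔_; mk⇔; Equivalence)
open import Level using (Level; _⊔_; suc)
open import Relation.Binary.Bundles using (Poset; Preorder)
open import Relation.Binary.Construct.Interior.Symmetric using (SymInterior)
open import Relation.Binary.Core using (REL)
open import Relation.Binary.Definitions using (Monotonic₂; AntitonicMonotonic; _Respects_)
open import Relation.Binary.Morphism.Structures using (IsOrderHomomorphism)
open import Relation.Binary.PropositionalEquality.Core using (_≡_; refl)
open import Relation.Unary using (Pred; _∈_; _⊇_; _≐_; ｛_｝)
open import Relation.Unary.Properties using (≐-refl; ≐-sym; ≐-trans)

-- Full adjunction implicative ordered combinatory algebras.
--
-- Inf-completeness is stated for families indexed by types in Set ℓ.  When the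
-- carrier itself lies in Set ℓ, these are the same as the infima of all subsets
-- P : Pred Carrier ℓ (take the family proj₁ : Σ Carrier P → Carrier).  The
-- carrier may lie in another universe because 𝒫• below, being made of subsets,
-- lies in Set (suc ℓ).

record FullAdjIOCA (c ℓ : Level) : Set (suc (c ⊔ ℓ)) where
  infixl 8 _·_
  infixr 7 _⇒_
  field
    poset : Poset c ℓ ℓ

  open Poset poset public
    using (Carrier; _≈_; _≤_; antisym)
    renaming (refl to ≤-refl; trans to ≤-trans; reflexive to ≤-reflexive)
  module Eq = Poset.Eq poset

  field
    ⋀          : {I : Set ℓ} → (I → Carrier) → Carrier
    ⋀-lower    : ∀ {I : Set ℓ} (f : I → Carrier) i → ⋀ f ≤ f i
    ⋀-greatest : ∀ {I : Set ℓ} (f : I → Carrier) x → (∀ i → x ≤ f i) → x ≤ ⋀ f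

    _·_        : Carrier → Carrier → Carrier
    _⇒_        : Carrier → Carrier → Carrier
    ·-mono     : Monotonic₂ _≤_ _≤_ _≤_ _·_
    ⇒-mono     : AntitonicMonotonic _≤_ _≤_ _≤_ _⇒_
    adjunction : ∀ a b c → a ≤ (b ⇒ c) ⇔ a · b ≤ c

    k s        : Carrier
    k-law      : ∀ a b → k · a · b ≤ a
    s-law      : ∀ a b c → s · a · b · c ≤ a · c · (b · c)

    Φ          : Pred Carrier ℓ
    Φ-resp-≈   : Φ Respects _≈_
    Φ-·        : ∀ {a b} → a ∈ Φ → b ∈ Φ → a · b ∈ Φ
    Φ-k        : k ∈ Φ
    Φ-s        : s ∈ Φ

  _⊑_ : Carrier → Carrier → Set (c ⊔ ℓ)
  a ⊑ a′ = ∃[ r ] r ∈ Φ × r · a ≤ a′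

  adj⇒ : ∀ {a b c} → a ≤ (b ⇒ c) → a · b ≤ c
  adj⇒ = Equivalence.to (adjunction _ _ _)

  adj⇐ : ∀ {a b c} → a · b ≤ c → a ≤ (b ⇒ c)
  adj⇐ = Equivalence.from (adjunction _ _ _)

  idᶜ : Carrier
  idᶜ = s · k · k

  idᶜ-law : ∀ a → idᶜ · a ≤ a
  idᶜ-law a = ≤-trans (s-law k k a) (k-law a (k · a))

  idᶜ∈Φ : idᶜ ∈ Φ
  idᶜ∈Φ = Φ-· (Φ-· Φ-s Φ-k) Φ-k

  compᶜ : Carrier → Carrier → Carrier
  compᶜ t r = s · (k · t) · r

  compᶜ-law : ∀ t r a → compᶜ t r · a ≤ t · (r · a)
  compᶜ-law t r a = ≤-trans (s-law (k · t) r a) (·-mono (k-law t a) ≤-refl)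

  compᶜ∈Φ : ∀ {t r} → t ∈ Φ → r ∈ Φ → compᶜ t r ∈ Φ
  compᶜ∈Φ t∈Φ r∈Φ = Φ-· (Φ-· Φ-s (Φ-· Φ-k t∈Φ)) r∈Φ

-- The Heyting operations of a Heyting preorder are determined by its preorder up
-- to isomorphism, and equivalences refer to the underlying preorders only.

heytingPreorder : ∀ {c ℓ} → FullAdjIOCA c ℓ → Preorder c ℓ (c ⊔ ℓ)
heytingPreorder A = record
  { Carrier    = Carrier
  ; _≈_        = _≈_
  ; _≲_        = _⊑_
  ; isPreorder = record
    { isEquivalence = Eq.isEquivalence
    ; reflexive     = λ {x} x≈y → idᶜ , idᶜ∈Φ , ≤-trans (idᶜ-law x) (≤-reflexive x≈y)
    ; trans         = λ {x} (r , r∈Φ , rx≤y) (t , t∈Φ , ty≤z) →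
        compᶜ t r , compᶜ∈Φ t∈Φ r∈Φ ,
        ≤-trans (compᶜ-law t r x) (≤-trans (·-mono ≤-refl rx≤y) ty≤z)
    }
  }
  where open FullAdjIOCA A

-- Abstract Krivine structures (intuitionistic: no control operator).

record AKS (ℓ : Level) : Set (suc ℓ) where
  field
    Λ Π  : Set ℓ
    _⫫_  : REL Λ Π ℓ
    app  : Λ → Λ → Λ
    push : Λ → Π → Π
    K S  : Λ
    QP   : Pred Λ ℓ

    app-law : ∀ t s π → t ⫫ push s π → app t s ⫫ π
    K-law   : ∀ t s π → t ⫫ π → K ⫫ push t (push s π)
    S-law   : ∀ t s u π → app (app t u) (app s u) ⫫ π → S ⫫ push t (push s (push u π))

    QP-app : ∀ {t s} → t ∈ QP → s ∈ QP → app t s ∈ QP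
    QP-K   : K ∈ QP
    QP-S   : S ∈ QP

module Polars {ℓ : Level} (𝒦 : AKS ℓ) where
  open AKS 𝒦

  ⊥⟨_⟩ : Pred Π ℓ → Pred Λ ℓ
  ⊥⟨ P ⟩ t = ∀ π → π ∈ P → t ⫫ π

  ⟨_⟩⊥ : Pred Λ ℓ → Pred Π ℓ
  ⟨ L ⟩⊥ π = ∀ t → t ∈ L → t ⫫ π

  closure : Pred Π ℓ → Pred Π ℓ
  closure P = ⟨ ⊥⟨ P ⟩ ⟩⊥

  hat : Pred Π ℓ → Pred Π ℓ
  hat P π′ = ∃[ π ] π ∈ P × π′ ∈ closure ｛ π ｝

  𝒫• : Set (suc ℓ)
  𝒫• = Σ[ P ∈ Pred Π ℓ ] hat P ≐ P

  ∣_∣• : 𝒫• → Pred Π ℓ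
  ∣_∣• = proj₁

  ⊥• : 𝒫• → Pred Λ ℓ
  ⊥• P = ⊥⟨ ∣ P ∣• ⟩

  ∈closure : ∀ π → π ∈ closure ｛ π ｝
  ∈closure π t t⫫ = t⫫ π refl

  closure-trans : ∀ {π π′ π″} → π′ ∈ closure ｛ π ｝ → π″ ∈ closure ｛ π′ ｝ → π″ ∈ closure ｛ π ｝
  closure-trans π′∈ π″∈ t t⫫ = π″∈ t λ { _ refl → π′∈ t t⫫ }

  hatClosed : (P : Pred Π ℓ) → (∀ {π π′} → π ∈ P → π′ ∈ closure ｛ π ｝ → π′ ∈ P) → hat P ≐ P
  hatClosed P up = (λ (_ , π∈P , π′∈) → up π∈P π′∈) , λ {π} π∈P → π , π∈P , ∈closure π

  up• : (P : 𝒫•) → ∀ {π π′} → π ∈ ∣ P ∣• → π′ ∈ closure ｛ π ｝ → π′ ∈ ∣ P ∣•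
  up• P π∈P π′∈ = proj₁ (proj₂ P) (_ , π∈P , π′∈)

  hat• : Pred Π ℓ → 𝒫•
  hat• P = hat P , hatClosed (hat P) λ (π , π∈P , π′∈) π″∈ → π , π∈P , closure-trans π′∈ π″∈

  polar• : Pred Λ ℓ → 𝒫•
  polar• L = ⟨ L ⟩⊥ , hatClosed ⟨ L ⟩⊥ λ {π} π∈ π′∈ t t∈L → π′∈ t λ { _ refl → π∈ t t∈L }

  infixl 8 _∘•_
  infixr 7 _→•_
  infix 4 _⊑•_ _≤•_

  _→•_ : 𝒫• → 𝒫• → 𝒫•
  C →• D = hat• λ ρ → ∃[ s ] ∃[ π ] s ∈ ⊥• C × π ∈ ∣ D ∣• × push s π ≡ ρ

  _∘•_ : 𝒫• → 𝒫• → 𝒫•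
  P ∘• Q = R , hatClosed R λ π∈R π′∈ s π″ s∈ π″∈ → π∈R s π″ s∈ (closure-trans π′∈ π″∈)
    where
    R : Pred Π ℓ
    R π = ∀ s π′ → s ∈ ⊥• Q → π′ ∈ closure ｛ π ｝ → push s π′ ∈ ∣ P ∣•

  _≤•_ : 𝒫• → 𝒫• → Set ℓ
  P ≤• Q = ∣ P ∣• ⊇ ∣ Q ∣•

  ⋃• : {I : Set ℓ} → (I → 𝒫•) → 𝒫•
  ⋃• {I} F = R , hatClosed R λ (i , π∈) π′∈ → i , up• (F i) π∈ π′∈
    where
    R : Pred Π ℓ
    R π = ∃[ i ] π ∈ ∣ F i ∣•

  Φ• : Pred 𝒫• ℓ
  Φ• P = ∃[ t ] t ∈ QP × t ∈ ⊥• P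

  _⊑•_ : 𝒫• → 𝒫• → Set ℓ
  C ⊑• D = ∃[ t ] t ∈ QP × t ∈ ⊥• (C →• D)

  poset• : Poset (suc ℓ) ℓ ℓ
  poset• = record
    { Carrier        = 𝒫•
    ; _≈_            = λ P Q → ∣ P ∣• ≐ ∣ Q ∣•
    ; _≤_            = _≤•_
    ; isPartialOrder = record
      { isPreorder = record
        { isEquivalence = record { refl = ≐-refl ; sym = ≐-sym ; trans = ≐-trans }
        ; reflexive     = proj₂
        ; trans         = λ P⊇Q Q⊇R x∈R → P⊇Q (Q⊇R x∈R)
        }
      ; antisym = λ P⊇Q Q⊇P → Q⊇P , P⊇Q
      }
    }

module _ {ℓ : Level} (A : FullAdjIOCA ℓ ℓ) where
  open FullAdjIOCA A

  𝒦• : AKS ℓ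
  𝒦• = record
    { Λ       = Carrier
    ; Π       = Carrier
    ; _⫫_     = _≤_
    ; app     = _·_
    ; push    = _⇒_
    ; K       = k
    ; S       = s
    ; QP      = Φ
    ; app-law = λ _ _ _ → adj⇒
    ; K-law   = λ t u π t≤π → adj⇐ (adj⇐ (≤-trans (k-law t u) t≤π))
    ; S-law   = λ t u v π h → adj⇐ (adj⇐ (adj⇐ (≤-trans (s-law t u v) h)))
    ; QP-app  = Φ-·
    ; QP-K    = Φ-k
    ; QP-S    = Φ-s
    }

  open Polars 𝒦•

  private
    ≤⇒∈closure : ∀ {π π′} → π ≤ π′ → π′ ∈ closure ｛ π ｝
    ≤⇒∈closure π≤π′ t t≤ = ≤-trans (t≤ _ refl) π≤π′

    ∈closure⇒≤ : ∀ {π π′} → π′ ∈ closure ｛ π ｝ → π ≤ π′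
    ∈closure⇒≤ {π} π′∈ = π′∈ π λ { _ refl → ≤-refl }

    ∈⊥→•⇒ : ∀ C D {t} → t ∈ ⊥• (C →• D) → ∀ {s π} → s ∈ ⊥• C → π ∈ ∣ D ∣• → t · s ≤ π
    ∈⊥→•⇒ C D t∈ s∈ π∈ = adj⇒ (t∈ _ (_ , (_ , _ , s∈ , π∈ , refl) , ∈closure _))

    ∈⊥→•⇐ : ∀ C D {t} → (∀ {s π} → s ∈ ⊥• C → π ∈ ∣ D ∣• → t · s ≤ π) → t ∈ ⊥• (C →• D)
    ∈⊥→•⇐ C D h π′ (_ , (_ , _ , s∈ , π∈ , refl) , π′∈) =
      ≤-trans (adj⇐ (h s∈ π∈)) (∈closure⇒≤ π′∈)

    →•-intro : ∀ (P Q R : 𝒫•) → P ≤• (Q →• R) → (P ∘• Q) ≤• R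
    →•-intro P Q R h π∈R s π′ s∈ π′∈ =
      h (_ , (s , π′ , s∈ , up• R π∈R π′∈ , refl) , ∈closure _)

    →•-elim : ∀ (P Q R : 𝒫•) → (P ∘• Q) ≤• R → P ≤• (Q →• R)
    →•-elim P Q R h (_ , (s , π , s∈ , π∈R , refl) , ρ∈) =
      up• P (h π∈R s π s∈ (∈closure π)) ρ∈

    ·∈⊥∘• : ∀ (P Q : 𝒫•) {t u} → t ∈ ⊥• P → u ∈ ⊥• Q → t · u ∈ ⊥• (P ∘• Q)
    ·∈⊥∘• P Q {t} {u} t∈ u∈ π π∈ = adj⇒ (t∈ _ (π∈ u π u∈ (∈closure π)))

  preorder• : Preorder (suc ℓ) ℓ ℓ
  preorder• = record
    { Carrier    = 𝒫•
    ; _≈_        = Poset._≈_ poset•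
    ; _≲_        = _⊑•_
    ; isPreorder = record
      { isEquivalence = Poset.isEquivalence poset•
      ; reflexive     = λ {C} {D} (_ , D⊆C) → idᶜ , idᶜ∈Φ ,
          ∈⊥→•⇐ C D λ s∈ π∈ → ≤-trans (idᶜ-law _) (s∈ _ (D⊆C π∈))
      ; trans         = λ {C} {D} {E} (r , r∈Φ , r∈) (t , t∈Φ , t∈) →
          compᶜ t r , compᶜ∈Φ t∈Φ r∈Φ ,
          ∈⊥→•⇐ C E λ s∈ π∈ → ≤-trans (compᶜ-law t r _)
            (∈⊥→•⇒ D E t∈ (λ _ → ∈⊥→•⇒ C D r∈ s∈) π∈)
      }
    }

  -- The order is reverse inclusion, so infima are unions.  The combinators are
  -- the polars of k and s.
  𝒜𝒦• : FullAdjIOCA (suc ℓ) ℓ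
  𝒜𝒦• = record
    { poset      = poset•
    ; ⋀          = ⋃•
    ; ⋀-lower    = λ F i π∈ → i , π∈
    ; ⋀-greatest = λ F P h (i , π∈) → h i π∈
    ; _·_        = _∘•_
    ; _⇒_        = _→•_
    ; ·-mono     = λ P⊇P′ Q⊇Q′ π∈ s π′ s∈ π′∈ →
        P⊇P′ (π∈ s π′ (λ _ ρ∈Q′ → s∈ _ (Q⊇Q′ ρ∈Q′)) π′∈)
    ; ⇒-mono     = λ C′⊇C D⊇D′ (ρ , (s , π , s∈ , π∈ , eq) , ρ∈) →
        ρ , (s , π , (λ _ σ∈ → s∈ _ (C′⊇C σ∈)) , D⊇D′ π∈ , eq) , ρ∈
    ; adjunction = λ P Q R → mk⇔ (→•-intro P Q R) (→•-elim P Q R)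
    ; k          = polar• ｛ k ｝
    ; s          = polar• ｛ s ｝
    ; k-law      = λ P Q {π} π∈P u π′ u∈ π′∈ t ρ t∈ ρ∈ → λ { _ refl →
        adj⇐ (≤-trans (adj⇐ (≤-trans (k-law t u) (≤-trans (t∈ π π∈P) (∈closure⇒≤ π′∈))))
                      (∈closure⇒≤ ρ∈)) }
    ; s-law      = λ P Q R {π} π∈ v π₁ v∈ π₁∈ u π₂ u∈ π₂∈ t π₃ t∈ π₃∈ → λ { _ refl →
        adj⇐ (≤-trans (adj⇐ (≤-trans (adj⇐ (≤-trans (s-law t u v)
          (≤-trans (·∈⊥∘• (P ∘• R) (Q ∘• R) (·∈⊥∘• P R t∈ v∈) (·∈⊥∘• Q R u∈ v∈) π π∈)
                   (∈closure⇒≤ π₁∈))))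
          (∈closure⇒≤ π₂∈))) (∈closure⇒≤ π₃∈)) }
    ; Φ          = Φ•
    ; Φ-resp-≈   = λ (_ , Q⊆P) (t , t∈Φ , t∈) → t , t∈Φ , λ π π∈Q → t∈ π (Q⊆P π∈Q)
    ; Φ-·        = λ {P} {Q} (t , t∈Φ , t∈) (u , u∈Φ , u∈) →
        t · u , Φ-· t∈Φ u∈Φ , ·∈⊥∘• P Q t∈ u∈
    ; Φ-k        = k , Φ-k , λ π π∈ → π∈ k refl
    ; Φ-s        = s , Φ-s , λ π π∈ → π∈ s refl
    }

  ρ : 𝒫• → Carrier
  ρ C = ⋀ {I = Σ Carrier ∣ C ∣•} proj₁

module _ {a b ℓ₁ ℓ₂ ℓ₃ ℓ₄} (P : Preorder a ℓ₁ ℓ₂) (Q : Preorder b ℓ₃ ℓ₄) where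
  private
    module P = Preorder P
    module Q = Preorder Q

  record IsPreorderEquivalence (f : P.Carrier → Q.Carrier) : Set (a ⊔ b ⊔ ℓ₁ ⊔ ℓ₂ ⊔ ℓ₃ ⊔ ℓ₄) where
    field
      monotone         : IsOrderHomomorphism P._≈_ Q._≈_ P._≲_ Q._≲_ f
      inverse          : Q.Carrier → P.Carrier
      inverse-monotone : IsOrderHomomorphism Q._≈_ P._≈_ Q._≲_ P._≲_ inverse
      inverseˡ         : ∀ x → SymInterior Q._≲_ (f (inverse x)) x
      inverseʳ         : ∀ x → SymInterior P._≲_ (inverse (f x)) x

  PreorderEquivalent : Set (a ⊔ b ⊔ ℓ₁ ⊔ ℓ₂ ⊔ ℓ₃ ⊔ ℓ₄)
  PreorderEquivalent = ∃ IsPreorderEquivalence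

{-# OPTIONS --safe #-}

-- Since s ∈ ⊥• C iff s ≤ inf C, the adjunction gives t ∈ ⊥• (C →• D) iff
-- t · inf C ≤ inf D.  Thus C ⊑• D and inf C ⊑ inf D have the same realizers, and
-- as every a is the infimum of its principal filter, inf is an equivalence.
-- In 𝒜𝒦• the filter element F := C →• D witnesses C ⊑ D whenever C ⊑• D.

module Submission where

open import Defs
open import Data.Product.Base using (_×_; _,_; proj₁; uncurry)
open import Function.Bundles using (_⇔_; mk⇔; module Equivalence)
open import Function.Construct.Composition using (_⇔-∘_)
open import Function.Definitions using (Congruent)
open import Level using (Level)
open import Relation.Binary.Bundles using (Preorder)
open import Relation.Binary.Construct.Interior.Symmetric using (_,_)
open import Relation.Binary.PropositionalEquality.Core using (refl)
open import Relation.Unary using (_∈_; ｛_｝)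

module _ {a b ℓ₁ ℓ₂ ℓ₃ ℓ₄} (P : Preorder a ℓ₁ ℓ₂) (Q : Preorder b ℓ₃ ℓ₄) where
  private
    module P = Preorder P
    module Q = Preorder Q

  -- As `f` reflects the order, any inequality between values of `g` may be checked after applying
  -- `f`, where `f (g y) ≈ y` cancels the two maps. The same argument at `g (f x)` gives the other
  -- composite.
  embedding+section⇒equivalence :
    (f : P.Carrier → Q.Carrier) (g : Q.Carrier → P.Carrier) →
    Congruent P._≈_ Q._≈_ f → Congruent Q._≈_ P._≈_ g →
    (∀ x y → x P.≲ y ⇔ f x Q.≲ f y) → (∀ y → f (g y) Q.≈ y) →
    IsPreorderEquivalence P Q f
  embedding+section⇒equivalence f g f-cong g-cong f-embeds section = record
    { monotone         = record { cong = f-cong ; mono = λ {x} {y} → to (f-embeds x y) }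
    ; inverse          = g
    ; inverse-monotone = record
      { cong = g-cong
      ; mono = λ {x} {y} x≲y → from (f-embeds (g x) (g y))
          (Q.trans (fg≲ x) (Q.trans x≲y (≲fg y)))
      }
    ; inverseˡ         = λ y → fg≲ y , ≲fg y
    ; inverseʳ         = λ x →
        from (f-embeds (g (f x)) x) (fg≲ (f x)) , from (f-embeds x (g (f x))) (≲fg (f x))
    }
    where
    open Equivalence using (to; from)
    fg≲ : ∀ y → f (g y) Q.≲ y
    fg≲ y = Q.reflexive (section y)
    ≲fg : ∀ y → y Q.≲ f (g y)
    ≲fg y = Q.reflexive (Q.Eq.sym (section y))

  IsPreorderEquivalence⇒PreorderEquivalent-sym :
    ∀ {f} → IsPreorderEquivalence P Q f → PreorderEquivalent Q P
  IsPreorderEquivalence⇒PreorderEquivalent-sym {f} eqv = inverse , record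
    { monotone         = inverse-monotone
    ; inverse          = f
    ; inverse-monotone = monotone
    ; inverseˡ         = inverseʳ
    ; inverseʳ         = inverseˡ
    }
    where open IsPreorderEquivalence eqv

module _ {ℓ : Level} (A : FullAdjIOCA ℓ ℓ) where
  open FullAdjIOCA A
  open Polars (𝒦• A)
  private
    module 𝒜• = FullAdjIOCA (𝒜𝒦• A)

    inf : 𝒫• → Carrier
    inf = ρ A

  ≤inf⇔∈⊥• : ∀ C t → t ≤ inf C ⇔ t ∈ ⊥• C
  ≤inf⇔∈⊥• C t = mk⇔
    (λ t≤ π π∈C → ≤-trans t≤ (⋀-lower proj₁ (π , π∈C)))
    (λ t∈ → ⋀-greatest proj₁ t (uncurry t∈))

  open module ≤inf⇔∈⊥• C {t} = Equivalence (≤inf⇔∈⊥• C t)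
    using () renaming (to to ≤inf⇒∈⊥•; from to ∈⊥•⇒≤inf)

  inf-mono : ∀ C D → C ≤• D → inf C ≤ inf D
  inf-mono C D D⊆C = ∈⊥•⇒≤inf D λ π π∈D → ⋀-lower proj₁ (π , D⊆C π∈D)

  inf-cong : Congruent 𝒜•._≈_ _≈_ inf
  inf-cong {C} {D} (C⊆D , D⊆C) = antisym (inf-mono C D D⊆C) (inf-mono D C C⊆D)

  ∈⊥→•⇔·inf≤inf : ∀ C D t → t ∈ ⊥• (C →• D) ⇔ t · inf C ≤ inf D
  ∈⊥→•⇔·inf≤inf C D t = mk⇔
    (λ t∈ → ∈⊥•⇒≤inf D λ π π∈D →
      -- `inf C` is itself in `⊥• C`, so `inf C ⇒ π` is one of the generators of `C →• D`.
      adj⇒ (t∈ _ (_ , (inf C , π , ≤inf⇒∈⊥• C ≤-refl , π∈D , refl) , ∈closure _)))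
    -- Elements added by `hat` lie above a generator `u ⇒ π`, so only generators matter; there
    -- `u ≤ inf C` gives `t · u ≤ inf D ≤ π`.
    (λ t·≤ → λ { _ (_ , (u , π , u∈ , π∈D , refl) , π′∈) → π′∈ t λ { _ refl →
      adj⇐ (≤-trans (·-mono ≤-refl (∈⊥•⇒≤inf C u∈)) (≤inf⇒∈⊥• D t·≤ π π∈D)) } })

  ⊑•⇔inf⊑inf : ∀ C D → C ⊑• D ⇔ inf C ⊑ inf D
  ⊑•⇔inf⊑inf C D = mk⇔
    (λ (t , t∈Φ , t∈) → t , t∈Φ , Equivalence.to (∈⊥→•⇔·inf≤inf C D t) t∈)
    (λ (t , t∈Φ , t·≤) → t , t∈Φ , Equivalence.from (∈⊥→•⇔·inf≤inf C D t) t·≤)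

  -- The principal filter of `a`; written as a polar, it is `hat`-closed by construction.
  principal : Carrier → 𝒫•
  principal a = polar• ｛ a ｝

  principal-cong : Congruent _≈_ 𝒜•._≈_ principal
  principal-cong a≈b =
    (λ π∈ → λ { _ refl → ≤-trans (≤-reflexive (Eq.sym a≈b)) (π∈ _ refl) }) ,
    (λ π∈ → λ { _ refl → ≤-trans (≤-reflexive a≈b) (π∈ _ refl) })

  inf-principal : ∀ a → inf (principal a) ≈ a
  inf-principal a = antisym
    -- By reflexivity `a` belongs to its own principal filter.
    (⋀-lower proj₁ (a , λ { _ refl → ≤-refl }))
    (∈⊥•⇒≤inf (principal a) λ π π∈ → π∈ a refl)

  𝒜•⊑⇔⊑• : ∀ C D → C 𝒜•.⊑ D ⇔ C ⊑• D
  𝒜•⊑⇔⊑• C D = mk⇔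
    (λ (F , (t , t∈Φ , t∈F) , F∘C≤D) →
      -- By adjunction `C →• D` is contained in `F`, so the realizer `t` of `F` also realizes
      -- `C →• D`.
      t , t∈Φ , λ π π∈ → t∈F π (𝒜•.adj⇐ {F} {C} {D} F∘C≤D π∈))
    -- `C ⊑• D` unfolds to membership of `C →• D` in `Φ•`; the inequality is modus ponens, the
    -- counit of the adjunction.
    (λ C⊑•D → C →• D , C⊑•D , 𝒜•.adj⇒ {C →• D} {C} {D} (𝒜•.≤-refl {C →• D}))

  inf-equivalence : IsPreorderEquivalence (preorder• A) (heytingPreorder A) inf
  inf-equivalence = embedding+section⇒equivalence (preorder• A) (heytingPreorder A)
    inf principal (λ {C} {D} → inf-cong {C} {D}) principal-cong ⊑•⇔inf⊑inf inf-principal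

  -- Carrier and `≈` are those of `preorder• A`; only the order differs, and `𝒜•⊑⇔⊑•` translates it.
  inf-equivalence-𝒜𝒦• :
    IsPreorderEquivalence (heytingPreorder (𝒜𝒦• A)) (heytingPreorder A) inf
  inf-equivalence-𝒜𝒦• =
    embedding+section⇒equivalence (heytingPreorder (𝒜𝒦• A)) (heytingPreorder A)
      inf principal (λ {C} {D} → inf-cong {C} {D}) principal-cong
      (λ C D → ⊑•⇔inf⊑inf C D ⇔-∘ 𝒜•⊑⇔⊑• C D) inf-principal

mainTheorem14 : {ℓ : Level} (A : FullAdjIOCA ℓ ℓ) →
    IsPreorderEquivalence (preorder• A) (heytingPreorder A) (ρ A)
    × PreorderEquivalent (heytingPreorder A) (heytingPreorder (𝒜𝒦• A))
mainTheorem14 A =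
  inf-equivalence A ,
  IsPreorderEquivalence⇒PreorderEquivalent-sym
    (heytingPreorder (𝒜𝒦• A)) (heytingPreorder A) (inf-equivalence-𝒜𝒦• A)
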